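{- Consider the transposition game on an infinite domain $D\subset\mathbb{Z}$, identified up to order isomorphism with one of $\mathbb{Z}$, $\mathbb{Z}_+$, $\mathbb{Z}_-$, with an initial sequence of $m$ distinct elements of $D$ and $n$ turns to be played ($n$ a positive integer). Pivots and the end $S$-block refer to the set $S$ of elements of the initial sequence. - If there is exactly one pivot, then the first player wins. - If there is more than one pivot, then Black wins. - If there is no pivot and - $D=\mathbb{Z}$, then the second player wins; - $D=\mathbb{Z}_+$, then the player who wants the parity of the final sequence to be the initial parity wins; - $D=\mathbb{Z}_-$, then the parity of the final sequence is determined as a function of $n$, the initial parity and the number $\ell$ of terms in the end $S$-block: if $n$ is even, the final parity is the initial one plus $n/2$ (modulo 2); if $n$ is odd, the final parity is the initial one plus $\ell+(n-1)/2$ (modulo 2).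
   Context: Transposition game: given a domain $D\subset\mathbb{R}$, a finite sequence of $m$ distinct elements of $D$, and a positive integer $n$, with at least $m+n$ elements in $D$. Two players alternate; at each turn the player to move appends to the sequence one element of $D$ not already in it. After $n$ turns the sequence has $m+n$ terms and the game ends. One player wants the parity of the final sequence to be even, the other wants it to be odd (which player has which goal is fixed before the game starts). The parity of a finite sequence of distinct reals is the parity (mod 2) of the number of transpositions needed to put it in order; the initial parity is the parity of the initial sequence. Black is the player who plays the last turn, and White is the player who plays the second last turn; so if $n$ is odd Black is the first player, and if $n$ is even White is the first player. The second player is the opponent of the first player. "A player wins" means that this player has a winning strategy. $S$ denotes the set of elements already in the sequence; elements of $D\setminus S$ are called free. For $a,b\in S$, write $a\sim_S b$ if $[a,b]\cap D\subset S$, where $[a,b]$ is the closed interval with endpoints $a$ and $b$; this is an equivalence relation and its classes are the $S$-blocks. A pivot is an $S$-block with an odd number of elements such that there exist two free elements, one of which is smaller and the other larger than the elements of the block. The end $S$-block is the $S$-block containing the last (largest) term of $D$; if there is no such block (in particular if $D$ has no last term), the end $S$-block is said to be empty and its number of terms is $0$. Every infinite subset of $\mathbb{Z}$ is order isomorphic to one of $\mathbb{Z}$, $\mathbb{Z}_+$ (the nonnegative integers), $\mathbb{Z}_-$ (the nonpositive integers), so there is no loss of generality in assuming that $D$ is one of these three sets.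
   Formalization: In the case of no pivot and D = ℤ, the claim that the second player wins is stated for n ≥ 2 only: for n = 1 the single move leaves the initial parity unchanged, so the claim fails when the first player wants the initial parity (e.g. empty S, first player wants even). -}

module Defs where

open import Data.Integer.Base using (ℤ; 0ℤ; _≤_; _<_)
open import Data.Integer.Properties using (≤-totalOrder)
open import Data.List.Base using (List; []; _∷_; _++_; _∷ʳ_; length)
open import Data.List.Membership.Propositional using (_∈_; _∉_)
open import Data.List.Relation.Unary.Sorted.TotalOrder ≤-totalOrder using (Sorted)
open import Data.List.Relation.Unary.Unique.Propositional using (Unique)
open import Data.Nat.Base using (ℕ; zero; suc; parity)
open import Data.Parity.Base using (Parity; 1ℙ)
open import Data.Product.Base using (_×_; ∃; ∃-syntax)
open import Data.Sum.Base using (_⊎_)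
open import Data.Unit.Base using (⊤)
open import Function.Bundles using (_⇔_)
open import Level using (0ℓ)
open import Relation.Binary.PropositionalEquality using (_≡_; _≢_)
open import Relation.Nullary.Negation using (¬_)
open import Relation.Unary using (Pred; _≐_)

data Domain : Set where
  ℤ-all ℤ₊ ℤ₋ : Domain

⟦_⟧ : Domain → Pred ℤ 0ℓ
⟦ ℤ-all ⟧ x = ⊤
⟦ ℤ₊    ⟧ x = 0ℤ ≤ x
⟦ ℤ₋    ⟧ x = x ≤ 0ℤ

-- The constructor swaps the entries at two different positions.
data Transposition : List ℤ → List ℤ → Set where
  swap : ∀ as x bs y cs →
         Transposition (as ++ x ∷ bs ++ y ∷ cs) (as ++ y ∷ bs ++ x ∷ cs)

data Transpositions : ℕ → List ℤ → List ℤ → Set where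
  done : ∀ {s} → Transpositions zero s s
  step : ∀ {k s t u} → Transposition s t → Transpositions k t u →
         Transpositions (suc k) s u

-- For a sequence of distinct terms the parity of k does not depend on how
-- the sequence is put in order, so exactly one p satisfies HasParity s p.
HasParity : List ℤ → Parity → Set
HasParity s p = ∃[ k ] ∃[ t ] (Transpositions k s t × Sorted t × parity k ≡ p)

data Player : Set where
  black white : Player

opponent : Player → Player
opponent black = white
opponent white = black

-- The player to move when k turns remain, for k ≥ 1: Black moves when k = 1
-- (the last turn), White when k = 2, and so on.  The value at 0 is not used.
toMove : ℕ → Player
toMove zero    = white
toMove (suc k) = opponent (toMove k)

firstPlayer secondPlayer : ℕ → Player
firstPlayer  n = toMove n
secondPlayer n = opponent (firstPlayer n)

HasSize : Pred ℤ 0ℓ → ℕ → Set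
HasSize B k = ∃[ xs ] (Unique xs × (∀ x → x ∈ xs ⇔ B x) × length xs ≡ k)

-- D is the domain and s the sequence of elements played so far; the set S of
-- the elements of s is represented by membership in s.
module Position (D : Pred ℤ 0ℓ) (s : List ℤ) where

  Free : Pred ℤ 0ℓ
  Free x = D x × x ∉ s

  -- The closed interval with endpoints a and b, in either order.
  [_,_] : ℤ → ℤ → Pred ℤ 0ℓ
  [ a , b ] x = (a ≤ x × x ≤ b) ⊎ (b ≤ x × x ≤ a)

  infix 4 _∼_
  _∼_ : ℤ → ℤ → Set
  a ∼ b = ∀ x → [ a , b ] x → D x → x ∈ s

  Class : ℤ → Pred ℤ 0ℓ
  Class a b = b ∈ s × a ∼ b

  -- Blocks, like all subsets here, are compared by extensional equality _≐_.
  IsBlock : Pred ℤ 0ℓ → Set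
  IsBlock B = ∃[ a ] (a ∈ s × B ≐ Class a)

  IsPivot : Pred ℤ 0ℓ → Set
  IsPivot B =
    IsBlock B ×
    (∃[ k ] (HasSize B k × parity k ≡ 1ℙ)) ×
    (∃[ u ] ∃[ v ] (Free u × Free v × (∀ b → B b → u < b) × (∀ b → B b → b < v)))

  NoPivot ExactlyOnePivot MoreThanOnePivot : Set₁
  NoPivot          = ∀ B → ¬ IsPivot B
  ExactlyOnePivot  = ∃[ B ] (IsPivot B × (∀ C → IsPivot C → C ≐ B))
  MoreThanOnePivot = ∃[ B ] ∃[ C ] (IsPivot B × IsPivot C × ¬ (B ≐ C))

  IsLast : Pred ℤ 0ℓ
  IsLast e = D e × (∀ x → D x → x ≤ e)

  -- Empty when D has no last term or when its last term is not in S.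
  EndBlock : Pred ℤ 0ℓ
  EndBlock x = ∃[ e ] (IsLast e × e ∈ s × Class e x)

-- The winning strategies (as strategy trees) of player P from the sequence s
-- with the given number of turns remaining, when each player Q wants the
-- final sequence to have parity goal Q.
data WinningStrategy (D : Pred ℤ 0ℓ) (goal : Player → Parity) (P : Player) :
                     ℕ → List ℤ → Set where
  finish : ∀ {s} → HasParity s (goal P) → WinningStrategy D goal P zero s
  play   : ∀ {k s} → toMove (suc k) ≡ P →
           ∀ x → Position.Free D s x → WinningStrategy D goal P k (s ∷ʳ x) →
           WinningStrategy D goal P (suc k) s
  answer : ∀ {k s} → toMove (suc k) ≢ P →
           (∀ x → Position.Free D s x → WinningStrategy D goal P k (s ∷ʳ x)) →
           WinningStrategy D goal P (suc k) s

{-# OPTIONS --safe #-}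

-- Colour a free element by the parity of the number of elements of S above it.
-- Pivots are the changes of colour along the free elements, and appending x
-- adds the colour of x to the parity of the sequence, removes x from the free
-- elements and flips the colours of the free elements below x.  Hence a move
-- changes the number of pivots by one, unless it is made at an end of the
-- domain.  With two pivots before a move of White, one is left for Black, who
-- then can choose the parity on the last turn and, on an earlier turn, restores
-- two pivots by a move far away.  With one pivot, White can move next to it on
-- either side, which removes the pivot with either parity.  Without pivots, any
-- move creates one and lets the opponent win, except the move at the end of a
-- half-line, so that there the game reduces to a sequence of forced moves.
module Submission where

open import Data.Integer.Base as ℤ using (ℤ; 0ℤ; -1ℤ; 1ℤ; _≤_; _<_; -_; ∣_∣; pred)
open import Data.Integer.Properties as ℤ using (_≟_; _<?_; _≤?_; ≤-totalOrder; ≤-decTotalOrder)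
open import Data.Empty using (⊥-elim)
open import Data.List.Base using (List; []; _∷_; [_]; _++_; _∷ʳ_; length; filter)
import Data.List.Extrema ≤-totalOrder as Extrema
open import Data.List.Membership.DecPropositional _≟_ using (_∈?_)
open import Data.List.Membership.Propositional using (_∈_; _∉_; find; lose)
open import Data.List.Membership.Propositional.Properties
  using (∈-filter⁺; ∈-filter⁻; ∈-++⁺ˡ; ∈-++⁺ʳ; ∈-++⁻)
open import Data.List.Membership.Propositional.Properties.WithK using (unique∧set⇒bag)
open import Data.List.Properties using (length-++; filter-++; filter-none; filter-accept; filter-reject)
open import Data.List.Relation.Binary.BagAndSetEquality using (∼bag⇒↭)
open import Data.List.Relation.Binary.Permutation.Propositional as ↭ using (_↭_; ↭-sym; ↭⇒↭ₛ)
open import Data.List.Relation.Binary.Permutation.Propositional.Properties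
  using (shift; ++⁺ˡ; ↭-length; filter-↭)
open import Data.List.Relation.Unary.All as All using (All; []; _∷_)
open import Data.List.Relation.Unary.AllPairs using (AllPairs; []; _∷_)
open import Data.List.Relation.Unary.Any using (here; there; any?)
open import Data.List.Relation.Unary.Sorted.TotalOrder ≤-totalOrder using (Sorted)
open import Data.List.Relation.Unary.Sorted.TotalOrder.Properties using (Sorted⇒AllPairs)
open import Data.List.Relation.Unary.Unique.Propositional using (Unique)
import Data.List.Relation.Unary.Unique.Propositional.Properties as Unique
open import Data.List.Sort ≤-decTotalOrder using (sort; sort-↭; sort-↗)
open import Data.Nat.Base as ℕ using (ℕ; zero; suc; parity; ⌊_/2⌋; _∸_)
open import Data.Parity.Base using (Parity; 0ℙ; 1ℙ; _⁻¹; _+_)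
open import Data.Parity.Properties as ℙ
  using (+-homo-+; ⁻¹-involutive; ⁻¹-injective; +-assoc; +-identityʳ; p≢p⁻¹; p+p≡0ℙ)
open import Algebra.Properties.CommutativeSemigroup ℙ.+-commutativeSemigroup using (interchange; x∙yz≈y∙xz)
open import Data.Product.Base as Product using (_×_; _,_; proj₁; proj₂; ∃-syntax)
open import Data.Sum.Base using (_⊎_; inj₁; inj₂)
open import Data.Unit.Base using (tt)
open import Defs
open import Function.Base using (_∘_; flip; id)
open import Function.Bundles using (_⇔_; mk⇔; Equivalence)
open import Level using (0ℓ)
open import Relation.Binary.Definitions using (Tri; tri<; tri≈; tri>)
open import Relation.Binary.PropositionalEquality
  using (_≡_; _≢_; refl; sym; trans; cong; cong₂; subst; setoid; module ≡-Reasoning)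
open import Relation.Nullary using (¬_; Dec; yes; no; contradiction; ¬?; _×-dec_)
open import Relation.Unary using (Pred; Decidable; _≐_)
open import Data.List.Relation.Binary.Permutation.Setoid.Properties (setoid ℤ) using (Unique-resp-↭)
open Position using (Free)

-- Parities and counting modulo 2.

parity-suc : ∀ n → parity (suc n) ≡ parity n ⁻¹
parity-suc = +-homo-+ 1

+-⁻¹ˡ : ∀ p q → p ⁻¹ + q ≡ (p + q) ⁻¹
+-⁻¹ˡ 0ℙ q = refl
+-⁻¹ˡ 1ℙ q = sym (⁻¹-involutive q)

+-⁻¹ʳ : ∀ p q → p + q ⁻¹ ≡ (p + q) ⁻¹
+-⁻¹ʳ 0ℙ q = refl
+-⁻¹ʳ 1ℙ q = refl

≢⇒≡⁻¹ : ∀ {p q} → p ≢ q → p ≡ q ⁻¹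
≢⇒≡⁻¹ {0ℙ} {0ℙ} p≢q = contradiction refl p≢q
≢⇒≡⁻¹ {0ℙ} {1ℙ} _   = refl
≢⇒≡⁻¹ {1ℙ} {0ℙ} _   = refl
≢⇒≡⁻¹ {1ℙ} {1ℙ} p≢q = contradiction refl p≢q

≢-≢⇒≡ : ∀ {p q r} → p ≢ q → q ≢ r → p ≡ r
≢-≢⇒≡ {r = r} p≢q q≢r =
  trans (≢⇒≡⁻¹ p≢q) (trans (cong _⁻¹ (≢⇒≡⁻¹ q≢r)) (⁻¹-involutive r))

module _ {P : Pred ℤ 0ℓ} (P? : Decidable P) where

  count : List ℤ → Parity
  count s = parity (length (filter P? s))

  count-++ : ∀ s t → count (s ++ t) ≡ count s + count t
  count-++ s t = begin
    parity (length (filter P? (s ++ t)))                       ≡⟨ cong (parity ∘ length) (filter-++ P? s t) ⟩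
    parity (length (filter P? s ++ filter P? t))               ≡⟨ cong parity (length-++ (filter P? s)) ⟩
    parity (length (filter P? s) ℕ.+ length (filter P? t))     ≡⟨ +-homo-+ (length (filter P? s)) _ ⟩
    count s + count t                                          ∎
    where open ≡-Reasoning

  count-↭ : ∀ {s t} → s ↭ t → count s ≡ count t
  count-↭ s↭t = cong parity (↭-length (filter-↭ P? s↭t))

  count-none : ∀ {s} → (∀ x → x ∈ s → ¬ P x) → count s ≡ 0ℙ
  count-none none = cong (parity ∘ length) (filter-none P? (All.tabulate λ {x} → none x))

  count-accept : ∀ {x} s → P x → count (x ∷ s) ≡ count s ⁻¹
  count-accept s px = trans (cong (parity ∘ length) (filter-accept P? px)) (parity-suc (length (filter P? s)))

  count-reject : ∀ {x} s → ¬ P x → count (x ∷ s) ≡ count s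
  count-reject s ¬px = cong (parity ∘ length) (filter-reject P? ¬px)

-- Colours, inversions and the parity of a sequence.

above below : List ℤ → ℤ → Parity
above s x = count (x <?_) s
below s x = count (_<? x) s

above-∷ʳ-< : ∀ s {x z} → z < x → above (s ∷ʳ x) z ≡ above s z ⁻¹
above-∷ʳ-< s {x} {z} z<x = begin
  above (s ∷ʳ x) z         ≡⟨ count-++ (z <?_) s [ x ] ⟩
  above s z + above [ x ] z ≡⟨ cong (above s z +_) (count-accept (z <?_) [] z<x) ⟩
  above s z + 1ℙ           ≡⟨ ℙ.+-comm (above s z) 1ℙ ⟩
  above s z ⁻¹             ∎
  where open ≡-Reasoning

above-∷ʳ-≥ : ∀ s {x z} → x ≤ z → above (s ∷ʳ x) z ≡ above s z
above-∷ʳ-≥ s {x} {z} x≤z = begin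
  above (s ∷ʳ x) z         ≡⟨ count-++ (z <?_) s [ x ] ⟩
  above s z + above [ x ] z ≡⟨ cong (above s z +_) (count-reject (z <?_) [] (ℤ.≤⇒≯ x≤z)) ⟩
  above s z + 0ℙ           ≡⟨ +-identityʳ (above s z) ⟩
  above s z                ∎
  where open ≡-Reasoning

-- The parity of the number of inversions, a computable counterpart of the existential `HasParity`.
inv : List ℤ → Parity
inv []      = 0ℙ
inv (x ∷ s) = below s x + inv s

-- The new term forms an inversion with exactly the larger earlier terms, so its colour is its
-- contribution.
inv-∷ʳ : ∀ s x → inv (s ∷ʳ x) ≡ inv s + above s x
inv-∷ʳ []      x = refl
inv-∷ʳ (y ∷ s) x = begin
  below (s ∷ʳ x) y + inv (s ∷ʳ x)                    ≡⟨ cong₂ _+_ (count-++ (_<? y) s [ x ]) (inv-∷ʳ s x) ⟩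
  (below s y + below [ x ] y) + (inv s + above s x)  ≡⟨ interchange (below s y) (below [ x ] y) (inv s) (above s x) ⟩
  inv (y ∷ s) + (below [ x ] y + above s x)          ≡⟨ cong (λ p → inv (y ∷ s) + (p + above s x)) singletons ⟩
  inv (y ∷ s) + (above [ y ] x + above s x)          ≡⟨ cong (inv (y ∷ s) +_) (count-++ (x <?_) [ y ] s) ⟨
  inv (y ∷ s) + above (y ∷ s) x                      ∎
  where
  open ≡-Reasoning
  singletons : below [ x ] y ≡ above [ y ] x
  singletons with x <? y
  ... | yes _ = refl
  ... | no  _ = refl

-- Only the pair `x`, `y` itself changes its order.
inv-adjacent : ∀ {x y} s → x ≢ y → inv (x ∷ y ∷ s) ≡ inv (y ∷ x ∷ s) ⁻¹
inv-adjacent {x} {y} s x≢y with ℤ.<-cmp x y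
... | tri≈ _ x≡y _ = contradiction x≡y x≢y
... | tri< x<y _ y≮x
  rewrite count-reject (_<? x) s y≮x | count-accept (_<? y) s x<y =
  flip₁ (below s x) (below s y) (inv s)
  where
  flip₁ : ∀ p q r → p + (q + r) ≡ (q ⁻¹ + (p + r)) ⁻¹
  flip₁ 0ℙ 0ℙ r = sym (⁻¹-involutive r)
  flip₁ 0ℙ 1ℙ r = refl
  flip₁ 1ℙ 0ℙ r = sym (⁻¹-involutive (r ⁻¹))
  flip₁ 1ℙ 1ℙ r = refl
... | tri> x≮y _ y<x
  rewrite count-accept (_<? x) s y<x | count-reject (_<? y) s x≮y =
  flip₂ (below s x) (below s y) (inv s)
  where
  flip₂ : ∀ p q r → p ⁻¹ + (q + r) ≡ (q + (p + r)) ⁻¹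
  flip₂ 0ℙ 0ℙ r = refl
  flip₂ 0ℙ 1ℙ r = refl
  flip₂ 1ℙ 0ℙ r = sym (⁻¹-involutive r)
  flip₂ 1ℙ 1ℙ r = sym (⁻¹-involutive (r ⁻¹))

-- Bringing `y` to the front takes one adjacent exchange for each entry of `bs`.
inv-shift : ∀ bs y cs → y ∉ bs →
            inv (bs ++ y ∷ cs) ≡ parity (length bs) + inv (y ∷ bs ++ cs)
inv-shift []       y cs _    = refl
inv-shift (b ∷ bs) y cs y∉bs = begin
  below (bs ++ y ∷ cs) b + inv (bs ++ y ∷ cs)
    ≡⟨ cong₂ _+_ (count-↭ (_<? b) (shift y bs cs)) (inv-shift bs y cs (y∉bs ∘ there)) ⟩
  below (y ∷ bs ++ cs) b + (parity (length bs) + inv (y ∷ bs ++ cs))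
    ≡⟨ x∙yz≈y∙xz (below (y ∷ bs ++ cs) b) (parity (length bs)) _ ⟩
  parity (length bs) + inv (b ∷ y ∷ bs ++ cs)
    ≡⟨ cong (parity (length bs) +_) (inv-adjacent (bs ++ cs) (y∉bs ∘ here ∘ sym)) ⟩
  parity (length bs) + inv (y ∷ b ∷ bs ++ cs) ⁻¹
    ≡⟨ +-⁻¹ʳ (parity (length bs)) _ ⟩
  (parity (length bs) + inv (y ∷ b ∷ bs ++ cs)) ⁻¹
    ≡⟨ +-⁻¹ˡ (parity (length bs)) _ ⟨
  parity (length bs) ⁻¹ + inv (y ∷ b ∷ bs ++ cs)
    ≡⟨ cong (_+ inv (y ∷ b ∷ bs ++ cs)) (parity-suc (length bs)) ⟨
  parity (length (b ∷ bs)) + inv (y ∷ b ∷ bs ++ cs) ∎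
  where
  open ≡-Reasoning

swap-↭ : ∀ (as : List ℤ) x bs y cs → as ++ x ∷ bs ++ y ∷ cs ↭ as ++ y ∷ bs ++ x ∷ cs
swap-↭ as x bs y cs = ++⁺ˡ as
  (↭.trans (↭.prep x (shift y bs cs)) (↭.trans (↭.swap x y ↭.refl) (↭.prep y (↭-sym (shift x bs cs)))))

Transposition⇒↭ : ∀ {s t} → Transposition s t → s ↭ t
Transposition⇒↭ (swap as x bs y cs) = swap-↭ as x bs y cs

-- In both lists the later of the two entries is pulled forward past `bs`. The two costs
-- `parity (length bs)` cancel, and a single adjacent exchange remains.
inv-swap : ∀ as x bs y cs → Unique (as ++ x ∷ bs ++ y ∷ cs) →
           inv (as ++ y ∷ bs ++ x ∷ cs) ≡ inv (as ++ x ∷ bs ++ y ∷ cs) ⁻¹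
inv-swap (a ∷ as) x bs y cs (_ ∷ u) = begin
  below (as ++ y ∷ bs ++ x ∷ cs) a + inv (as ++ y ∷ bs ++ x ∷ cs)
    ≡⟨ cong₂ _+_ (count-↭ (_<? a) (swap-↭ as y bs x cs)) (inv-swap as x bs y cs u) ⟩
  below (as ++ x ∷ bs ++ y ∷ cs) a + inv (as ++ x ∷ bs ++ y ∷ cs) ⁻¹
    ≡⟨ +-⁻¹ʳ (below (as ++ x ∷ bs ++ y ∷ cs) a) _ ⟩
  inv (a ∷ as ++ x ∷ bs ++ y ∷ cs) ⁻¹ ∎
  where
  open ≡-Reasoning
inv-swap [] x bs y cs (x∉ ∷ u) = begin
  below (bs ++ x ∷ cs) y + inv (bs ++ x ∷ cs)
    ≡⟨ cong₂ _+_ (count-↭ (_<? y) (shift x bs cs)) (inv-shift bs x cs x∉bs) ⟩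
  below (x ∷ bs ++ cs) y + (parity (length bs) + inv (x ∷ bs ++ cs))
    ≡⟨ x∙yz≈y∙xz (below (x ∷ bs ++ cs) y) (parity (length bs)) _ ⟩
  parity (length bs) + inv (y ∷ x ∷ bs ++ cs)
    ≡⟨ cong (parity (length bs) +_) (inv-adjacent (bs ++ cs) (x≢y ∘ sym)) ⟩
  parity (length bs) + inv (x ∷ y ∷ bs ++ cs) ⁻¹
    ≡⟨ +-⁻¹ʳ (parity (length bs)) _ ⟩
  (parity (length bs) + inv (x ∷ y ∷ bs ++ cs)) ⁻¹
    ≡⟨ cong _⁻¹ (x∙yz≈y∙xz (below (y ∷ bs ++ cs) x) (parity (length bs)) _) ⟨
  (below (y ∷ bs ++ cs) x + (parity (length bs) + inv (y ∷ bs ++ cs))) ⁻¹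
    ≡⟨ cong _⁻¹ (cong₂ _+_ (count-↭ (_<? x) (shift y bs cs)) (inv-shift bs y cs y∉bs)) ⟨
  (below (bs ++ y ∷ cs) x + inv (bs ++ y ∷ cs)) ⁻¹ ∎
  where
  open ≡-Reasoning
  x≢y : x ≢ y
  x≢y = All.lookup x∉ (∈-++⁺ʳ bs (here refl))
  x∉bs : x ∉ bs
  x∉bs x∈bs = All.lookup x∉ (∈-++⁺ˡ x∈bs) refl
  y∉bs : y ∉ bs
  y∉bs y∈bs with Unique-resp-↭ (↭⇒↭ₛ (shift y bs cs)) u
  ... | y∉ ∷ _ = All.lookup y∉ (∈-++⁺ˡ y∈bs) refl

inv-Transpositions : ∀ {k s t} → Unique s → Transpositions k s t → inv s ≡ parity k + inv t
inv-Transpositions u done = refl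
inv-Transpositions {suc k} {s} {t} u (step {t = s′} τ τs) = begin
  inv s                       ≡⟨ ⁻¹-involutive (inv s) ⟨
  inv s ⁻¹ ⁻¹                 ≡⟨ cong _⁻¹ (inv-step τ u) ⟨
  inv s′ ⁻¹                   ≡⟨ cong _⁻¹ (inv-Transpositions (Unique-resp-↭ (↭⇒↭ₛ (Transposition⇒↭ τ)) u) τs) ⟩
  1ℙ + (parity k + inv t)     ≡⟨ +-assoc 1ℙ (parity k) (inv t) ⟨
  (1ℙ + parity k) + inv t     ≡⟨ cong (_+ inv t) (parity-suc k) ⟨
  parity (suc k) + inv t      ∎
  where
  open ≡-Reasoning
  inv-step : ∀ {s t} → Transposition s t → Unique s → inv t ≡ inv s ⁻¹
  inv-step (swap as x bs y cs) = inv-swap as x bs y cs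

inv-sorted : ∀ {s} → Sorted s → inv s ≡ 0ℙ
inv-sorted = go ∘ Sorted⇒AllPairs ≤-totalOrder
  where
  go : ∀ {s} → AllPairs _≤_ s → inv s ≡ 0ℙ
  go []                 = refl
  go {x ∷ s} (x≤s ∷ s↗) =
    cong₂ _+_ (count-none (_<? x) λ y y∈s → ℤ.≤⇒≯ (All.lookup x≤s y∈s)) (go s↗)

-- A sorted list has no inversions and each transposition on the way to it flips `inv`, so only one
-- parity is possible.
HasParity⇒inv : ∀ {s p} → Unique s → HasParity s p → p ≡ inv s
HasParity⇒inv {s} {p} u (k , t , τs , t↗ , k≡p) = begin
  p                 ≡⟨ k≡p ⟨
  parity k          ≡⟨ +-identityʳ (parity k) ⟨
  parity k + 0ℙ     ≡⟨ cong (parity k +_) (inv-sorted t↗) ⟨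
  parity k + inv t  ≡⟨ inv-Transpositions u τs ⟨
  inv s             ∎
  where open ≡-Reasoning

Transpositions-prep : ∀ {k s t} x → Transpositions k s t → Transpositions k (x ∷ s) (x ∷ t)
Transpositions-prep x done                             = done
Transpositions-prep x (step (swap as a bs b cs) τs) = step (swap (x ∷ as) a bs b cs) (Transpositions-prep x τs)

Transpositions-++ : ∀ {k l s t u} → Transpositions k s t → Transpositions l t u →
                    Transpositions (k ℕ.+ l) s u
Transpositions-++ done        τs′ = τs′
Transpositions-++ (step τ τs) τs′ = step τ (Transpositions-++ τs τs′)

↭⇒Transpositions : ∀ {s t} → s ↭ t → ∃[ k ] Transpositions k s t
↭⇒Transpositions ↭.refl           = zero , done
↭⇒Transpositions (↭.prep x p)     = let k , τs = ↭⇒Transpositions p in k , Transpositions-prep x τs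
↭⇒Transpositions (↭.swap x y p)   =
  let k , τs = ↭⇒Transpositions p
  in suc k , step (swap [] x [] y _) (Transpositions-prep y (Transpositions-prep x τs))
↭⇒Transpositions (↭.trans p q)    =
  let k , τs = ↭⇒Transpositions p
      l , τs′ = ↭⇒Transpositions q
  in k ℕ.+ l , Transpositions-++ τs τs′

-- Sorting provides some number of transpositions; its parity is then forced by `HasParity⇒inv`.
inv⇒HasParity : ∀ {s} → Unique s → HasParity s (inv s)
inv⇒HasParity {s} u =
  let k , τs = ↭⇒Transpositions (↭-sym (sort-↭ s))
  in k , sort s , τs , sort-↗ s , HasParity⇒inv u (k , sort s , τs , sort-↗ s , refl)

-- Discrete search in the integers, and the three domains.

greatestBelow : ∀ {P : Pred ℤ 0ℓ} → Decidable P → ∀ {x y} → P y → y < x →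
                ∃[ a ] (P a × a < x × (∀ z → P z → z < x → z ≤ a))
greatestBelow {P} P? {x} {y} py y<x = go ∣ x ℤ.- y ∣ x y<x x≤
  where
  x≤ : x ≤ ℤ.+ ∣ x ℤ.- y ∣ ℤ.+ y
  x≤ = ℤ.≤-reflexive (sym (begin
    ℤ.+ ∣ x ℤ.- y ∣ ℤ.+ y  ≡⟨ cong (λ i → i ℤ.+ y) (ℤ.0≤i⇒+∣i∣≡i (ℤ.i≤j⇒0≤j-i (ℤ.<⇒≤ y<x))) ⟩
    x ℤ.- y ℤ.+ y          ≡⟨ ℤ.+-assoc x (- y) y ⟩
    x ℤ.+ (- y ℤ.+ y)      ≡⟨ cong (λ i → x ℤ.+ i) (ℤ.+-inverseˡ y) ⟩
    x ℤ.+ 0ℤ               ≡⟨ ℤ.+-identityʳ x ⟩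
    x                      ∎))
    where open ≡-Reasoning
  -- The search descends from `x`; `d` bounds the distance to the witness `y` and makes it
  -- terminate.
  go : ∀ d x → y < x → x ≤ ℤ.+ d ℤ.+ y → ∃[ a ] (P a × a < x × (∀ z → P z → z < x → z ≤ a))
  go zero    x y<x x≤ = contradiction (subst (x ≤_) (ℤ.+-identityˡ y) x≤) (ℤ.<⇒≱ y<x)
  go (suc d) x y<x x≤ with P? (pred x)
  ... | yes pa = pred x , pa , ℤ.i≤pred[j]⇒i<j ℤ.≤-refl , λ z _ → ℤ.i<j⇒i≤pred[j]
  ... | no ¬pa =
    let a , pa , a< , greatest = go d (pred x) (below-pred py y<x) pred-x≤
    in a , pa , ℤ.<-≤-trans a< (ℤ.i≤j⇒pred[i]≤j ℤ.≤-refl) ,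
       λ z pz z<x → greatest z pz (below-pred pz z<x)
    where
    below-pred : ∀ {z} → P z → z < x → z < pred x
    below-pred pz z<x = ℤ.≤∧≢⇒< (ℤ.i<j⇒i≤pred[j] z<x) λ { refl → ¬pa pz }
    pred-x≤ : pred x ≤ ℤ.+ d ℤ.+ y
    pred-x≤ = subst (pred x ≤_)
      (trans (cong pred (ℤ.+-assoc 1ℤ (ℤ.+ d) y)) (ℤ.pred-suc (ℤ.+ d ℤ.+ y)))
      (ℤ.pred-mono x≤)

leastAbove : ∀ {P : Pred ℤ 0ℓ} → Decidable P → ∀ {x y} → P y → x < y →
             ∃[ b ] (P b × x < b × (∀ z → P z → x < z → b ≤ z))
leastAbove {P} P? {x} {y} py x<y =
  let a , pa , a<-x , greatest = greatestBelow (P? ∘ -_) (neg-P py) (ℤ.neg-mono-< x<y)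
  in - a , pa , subst (_< - a) (ℤ.neg-involutive x) (ℤ.neg-mono-< a<-x) ,
     λ z pz x<z → subst (- a ≤_) (ℤ.neg-involutive z)
       (ℤ.neg-mono-≤ (greatest (- z) (neg-P pz) (ℤ.neg-mono-< x<z)))
  where
  neg-P : ∀ {z} → P z → P (- - z)
  neg-P {z} = subst P (sym (ℤ.neg-involutive z))

domain? : ∀ D → Decidable ⟦ D ⟧
domain? ℤ-all x = yes tt
domain? ℤ₊    x = 0ℤ ≤? x
domain? ℤ₋    x = x ≤? 0ℤ

convex : ∀ D {x y z} → ⟦ D ⟧ x → ⟦ D ⟧ y → x ≤ z → z ≤ y → ⟦ D ⟧ z
convex ℤ-all _   _   _   _   = tt
convex ℤ₊    0≤x _   x≤z _   = ℤ.≤-trans 0≤x x≤z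
convex ℤ₋    _   y≤0 _   z≤y = ℤ.≤-trans z≤y y≤0

free? : ∀ D s → Decidable (Free ⟦ D ⟧ s)
free? D s x = domain? D x ×-dec ¬? (x ∈? s)

UpwardClosed DownwardClosed : Pred ℤ 0ℓ → Set
UpwardClosed   D = ∀ {x y} → D x → x ≤ y → D y
DownwardClosed D = ∀ {x y} → D x → y ≤ x → D y

-- Provides a side on which Black can move far away from `s`. On `ℤ-all` either side would do.
infinite : ∀ D → UpwardClosed ⟦ D ⟧ ⊎ DownwardClosed ⟦ D ⟧
infinite ℤ-all = inj₁ λ _ _ → tt
infinite ℤ₊    = inj₁ ℤ.≤-trans
infinite ℤ₋    = inj₂ (flip ℤ.≤-trans)

0<1 : 0ℤ < 1ℤ
0<1 = ℤ.+<+ (ℕ.s≤s ℕ.z≤n)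

i<suc[i] : ∀ i → i < ℤ.suc i
i<suc[i] i = ℤ.suc[i]≤j⇒i<j ℤ.≤-refl

pred[i]<i : ∀ i → pred i < i
pred[i]<i i = ℤ.i≤pred[j]⇒i<j ℤ.≤-refl

-- Adding two different parities to `r` yields both parities; a player who can play either colour
-- thus decides the parity of the sequence.
choose : ∀ {p q} → p ≢ q → ∀ r g → r + p ≡ g ⊎ r + q ≡ g
choose {p} {q} p≢q r g with r + q ℙ.≟ g
... | yes eq = inj₂ eq
... | no neq = inj₁ (trans (cong (r +_) (≢⇒≡⁻¹ p≢q)) (trans (+-⁻¹ʳ r q) (sym (≢⇒≡⁻¹ (neq ∘ sym)))))

inv-move : ∀ s {x p g} → above s x ≡ p → inv s + p ≡ g → inv (s ∷ʳ x) ≡ g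
inv-move s {x} ax≡p eq = trans (inv-∷ʳ s x) (trans (cong (inv s +_) ax≡p) eq)

-- Patterns of colours and their change under a move.

module Colouring (D : Domain) where

  freeAbove : UpwardClosed ⟦ D ⟧ → ∀ s {b} → ⟦ D ⟧ b →
              ∃[ M ] (b < M × (∀ {z} → z ∈ s → z < M) × (∀ {z} → M ≤ z → Free ⟦ D ⟧ s z))
  freeAbove up s {b} Db =
    ℤ.suc m , ℤ.≤-<-trans (Extrema.⊥≤max b s) (i<suc[i] m) , s<M ,
    λ M≤z → up Db (ℤ.≤-trans (ℤ.≤-trans (Extrema.⊥≤max b s) (ℤ.i≤suc[i] m)) M≤z) ,
            λ z∈s → ℤ.<⇒≱ (s<M z∈s) M≤z
    where
    -- `b` is the initial value of the maximum, so that `M` exceeds `b` even if `s` is empty.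
    m = Extrema.max b s
    s<M : ∀ {z} → z ∈ s → z < ℤ.suc m
    s<M z∈s = ℤ.≤-<-trans (All.lookup (Extrema.xs≤max b s) z∈s) (i<suc[i] m)

  freeBelow : DownwardClosed ⟦ D ⟧ → ∀ s {b} → ⟦ D ⟧ b →
              ∃[ M ] (M < b × (∀ {z} → z ≤ M → Free ⟦ D ⟧ s z))
  freeBelow down s {b} Db =
    pred m , ℤ.<-≤-trans (pred[i]<i m) (Extrema.min≤⊤ b s) ,
    λ z≤M → down Db (ℤ.≤-trans z≤M (ℤ.≤-trans (ℤ.<⇒≤ (pred[i]<i m)) (Extrema.min≤⊤ b s))) ,
            λ z∈s → ℤ.<⇒≱ (ℤ.<-≤-trans (pred[i]<i m) (All.lookup (Extrema.min≤xs b s) z∈s)) z≤M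
    where
    m = Extrema.min b s

  free-∷ʳ⁺ : ∀ {s x z} → Free ⟦ D ⟧ s z → z ≢ x → Free ⟦ D ⟧ (s ∷ʳ x) z
  free-∷ʳ⁺ {s} (Dz , z∉s) z≢x = Dz , λ z∈ → case-∈ (∈-++⁻ s z∈)
    where
    case-∈ : _ ∈ s ⊎ _ ∈ [ _ ] → _
    case-∈ (inj₁ z∈s)        = z∉s z∈s
    case-∈ (inj₂ (here z≡x)) = z≢x z≡x

  free-∷ʳ⁻ : ∀ {s x z} → Free ⟦ D ⟧ (s ∷ʳ x) z → Free ⟦ D ⟧ s z × z ≢ x
  free-∷ʳ⁻ {s} (Dz , z∉) = (Dz , z∉ ∘ ∈-++⁺ˡ) , λ z≡x → z∉ (∈-++⁺ʳ s (here z≡x))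

  unique-∷ʳ : ∀ {s x} → Unique s → Free ⟦ D ⟧ s x → Unique (s ∷ʳ x)
  unique-∷ʳ u (_ , x∉s) = Unique.++⁺ u ([] ∷ []) λ { (x∈s , here refl) → x∉s x∈s }

  -- The four patterns stand for numbers of pivots: `Uniform` for none, `Split` for exactly one,
  -- `Mixed` for at least one and `Alternating` for at least two.
  Uniform : List ℤ → Parity → Set
  Uniform s e = ∀ x → Free ⟦ D ⟧ s x → above s x ≡ e

  record Split (s : List ℤ) (e : Parity) : Set where
    field
      {a b}  : ℤ
      a-free : Free ⟦ D ⟧ s a
      b-free : Free ⟦ D ⟧ s b
      a<b    : a < b
      gap    : ∀ x → Free ⟦ D ⟧ s x → x ≤ a ⊎ b ≤ x
      lower  : ∀ x → Free ⟦ D ⟧ s x → x ≤ a → above s x ≡ e ⁻¹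
      upper  : ∀ x → Free ⟦ D ⟧ s x → b ≤ x → above s x ≡ e

  record Mixed (s : List ℤ) : Set where
    field
      {u v}  : ℤ
      u-free : Free ⟦ D ⟧ s u
      v-free : Free ⟦ D ⟧ s v
      u<v    : u < v
      u≢v    : above s u ≢ above s v

  record Alternating (s : List ℤ) : Set where
    field
      {u v w} : ℤ
      u-free  : Free ⟦ D ⟧ s u
      v-free  : Free ⟦ D ⟧ s v
      w-free  : Free ⟦ D ⟧ s w
      u<v     : u < v
      v<w     : v < w
      u≢v     : above s u ≢ above s v
      v≢w     : above s v ≢ above s w

  split⇒mixed : ∀ {s e} → Split s e → Mixed s
  split⇒mixed {s} {e} σ = record
    { u-free = a-free ; v-free = b-free ; u<v = a<b
    ; u≢v = λ a≡b → p≢p⁻¹ e (begin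
        e         ≡⟨ upper _ b-free ℤ.≤-refl ⟨
        above s b ≡⟨ a≡b ⟨
        above s a ≡⟨ lower _ a-free ℤ.≤-refl ⟩
        e ⁻¹      ∎)
    }
    where
    open Split σ
    open ≡-Reasoning

  -- The pair on the side of `v` away from `x` is flipped as a whole or not at all, so it keeps its
  -- colour difference. If `x` is `v`, then `u` and `w`, of equal colour before, are separated
  -- because only `u` is flipped.
  alternating-move : ∀ {s x} → Alternating s → Mixed (s ∷ʳ x)
  alternating-move {s} {x} α with ℤ.<-cmp x v
    where open Alternating α
  ... | tri< x<v _ _ = record
    { u-free = free-∷ʳ⁺ v-free (ℤ.<⇒≢ x<v ∘ sym)
    ; v-free = free-∷ʳ⁺ w-free (ℤ.<⇒≢ x<w ∘ sym)
    ; u<v = v<w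
    ; u≢v = λ eq → v≢w (trans (sym (above-∷ʳ-≥ s (ℤ.<⇒≤ x<v))) (trans eq (above-∷ʳ-≥ s (ℤ.<⇒≤ x<w))))
    }
    where
    open Alternating α
    x<w = ℤ.<-trans x<v v<w
  ... | tri> _ _ v<x = record
    { u-free = free-∷ʳ⁺ u-free (ℤ.<⇒≢ u<x)
    ; v-free = free-∷ʳ⁺ v-free (ℤ.<⇒≢ v<x)
    ; u<v = u<v
    ; u≢v = λ eq → u≢v (⁻¹-injective (trans (sym (above-∷ʳ-< s u<x)) (trans eq (above-∷ʳ-< s v<x))))
    }
    where
    open Alternating α
    u<x = ℤ.<-trans u<v v<x
  ... | tri≈ _ refl _ = record
    { u-free = free-∷ʳ⁺ u-free (ℤ.<⇒≢ u<v)
    ; v-free = free-∷ʳ⁺ w-free (ℤ.<⇒≢ v<w ∘ sym)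
    ; u<v = ℤ.<-trans u<v v<w
    ; u≢v = λ eq → p≢p⁻¹ (above s w) (sym (begin
        above s w ⁻¹       ≡⟨ cong _⁻¹ (≢-≢⇒≡ u≢v v≢w) ⟨
        above s u ⁻¹       ≡⟨ above-∷ʳ-< s u<v ⟨
        above (s ∷ʳ v) u   ≡⟨ eq ⟩
        above (s ∷ʳ v) w   ≡⟨ above-∷ʳ-≥ s (ℤ.<⇒≤ v<w) ⟩
        above s w          ∎))
    }
    where
    open Alternating α
    open ≡-Reasoning

  -- The third witness is `suc M`, above `s` and `v`. If it has the colour of `v`, playing `M` flips
  -- `u` and `v` but not `suc M`; otherwise a move above it flips all three and keeps their
  -- differences.
  mixed-move↑ : UpwardClosed ⟦ D ⟧ → ∀ {s} → Mixed s → ∃[ x ] (Free ⟦ D ⟧ s x × Alternating (s ∷ʳ x))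
  mixed-move↑ up {s} μ with freeAbove up s (proj₁ (Mixed.v-free μ))
  ... | M , v<M , _ , free with above s (ℤ.suc M) ℙ.≟ above s (Mixed.v μ)
  ...   | yes w≡v = M , free ℤ.≤-refl , record
    { u-free = free-∷ʳ⁺ u-free (ℤ.<⇒≢ u<M)
    ; v-free = free-∷ʳ⁺ v-free (ℤ.<⇒≢ v<M)
    ; w-free = free-∷ʳ⁺ (free (ℤ.i≤suc[i] M)) (ℤ.<⇒≢ (i<suc[i] M) ∘ sym)
    ; u<v = u<v
    ; v<w = ℤ.<-trans v<M (i<suc[i] M)
    ; u≢v = λ eq → u≢v (⁻¹-injective (trans (sym (above-∷ʳ-< s u<M)) (trans eq (above-∷ʳ-< s v<M))))
    ; v≢w = λ eq → p≢p⁻¹ (above s v)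
        (trans (sym w≡v) (trans (sym (above-∷ʳ-≥ s (ℤ.i≤suc[i] M))) (trans (sym eq) (above-∷ʳ-< s v<M))))
    }
    where
    open Mixed μ
    u<M = ℤ.<-trans u<v v<M
  ...   | no w≢v = N , free (ℤ.<⇒≤ (ℤ.<-trans (i<suc[i] M) w<N)) , record
    { u-free = free-∷ʳ⁺ u-free (ℤ.<⇒≢ u<N)
    ; v-free = free-∷ʳ⁺ v-free (ℤ.<⇒≢ v<N)
    ; w-free = free-∷ʳ⁺ (free (ℤ.i≤suc[i] M)) (ℤ.<⇒≢ w<N)
    ; u<v = u<v
    ; v<w = v<w
    ; u≢v = λ eq → u≢v (⁻¹-injective (trans (sym (above-∷ʳ-< s u<N)) (trans eq (above-∷ʳ-< s v<N))))
    ; v≢w = λ eq → w≢v (sym (⁻¹-injective (trans (sym (above-∷ʳ-< s v<N)) (trans eq (above-∷ʳ-< s w<N)))))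
    }
    where
    open Mixed μ
    N   = ℤ.suc (ℤ.suc M)
    w<N = i<suc[i] (ℤ.suc M)
    v<w = ℤ.<-trans v<M (i<suc[i] M)
    v<N = ℤ.<-trans v<w w<N
    u<N = ℤ.<-trans u<v v<N

  -- The third witness is `pred M`, below `s` and `u`. If it has the colour of `u`, playing `M`
  -- flips it alone; otherwise a move below it changes none of the three colours.
  mixed-move↓ : DownwardClosed ⟦ D ⟧ → ∀ {s} → Mixed s → ∃[ x ] (Free ⟦ D ⟧ s x × Alternating (s ∷ʳ x))
  mixed-move↓ down {s} μ with freeBelow down s (proj₁ (Mixed.u-free μ))
  ... | M , M<u , free with above s (pred M) ℙ.≟ above s (Mixed.u μ)
  ...   | yes w≡u = M , free ℤ.≤-refl , record
    { u-free = free-∷ʳ⁺ (free (ℤ.<⇒≤ w<M)) (ℤ.<⇒≢ w<M)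
    ; v-free = free-∷ʳ⁺ u-free (ℤ.<⇒≢ M<u ∘ sym)
    ; w-free = free-∷ʳ⁺ v-free (ℤ.<⇒≢ M<v ∘ sym)
    ; u<v = ℤ.<-trans w<M M<u
    ; v<w = u<v
    ; u≢v = λ eq → p≢p⁻¹ (above s u)
        (trans (sym (above-∷ʳ-≥ s (ℤ.<⇒≤ M<u))) (trans (sym eq) (trans (above-∷ʳ-< s w<M) (cong _⁻¹ w≡u))))
    ; v≢w = λ eq → u≢v (trans (sym (above-∷ʳ-≥ s (ℤ.<⇒≤ M<u))) (trans eq (above-∷ʳ-≥ s (ℤ.<⇒≤ M<v))))
    }
    where
    open Mixed μ
    M<v = ℤ.<-trans M<u u<v
    w<M = pred[i]<i M
  ...   | no w≢u = N , free (ℤ.<⇒≤ (ℤ.<-trans N<w (pred[i]<i M))) , record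
    { u-free = free-∷ʳ⁺ (free (ℤ.<⇒≤ (pred[i]<i M))) (ℤ.<⇒≢ N<w ∘ sym)
    ; v-free = free-∷ʳ⁺ u-free (ℤ.<⇒≢ N<u ∘ sym)
    ; w-free = free-∷ʳ⁺ v-free (ℤ.<⇒≢ N<v ∘ sym)
    ; u<v = w<u
    ; v<w = u<v
    ; u≢v = λ eq → w≢u (trans (sym (above-∷ʳ-≥ s (ℤ.<⇒≤ N<w))) (trans eq (above-∷ʳ-≥ s (ℤ.<⇒≤ N<u))))
    ; v≢w = λ eq → u≢v (trans (sym (above-∷ʳ-≥ s (ℤ.<⇒≤ N<u))) (trans eq (above-∷ʳ-≥ s (ℤ.<⇒≤ N<v))))
    }
    where
    open Mixed μ
    N   = pred (pred M)
    N<w = pred[i]<i (pred M)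
    w<u = ℤ.<-trans (pred[i]<i M) M<u
    N<u = ℤ.<-trans N<w w<u
    N<v = ℤ.<-trans N<u u<v

  mixed-lastMove : ∀ {s} → Mixed s → ∀ g → ∃[ x ] (Free ⟦ D ⟧ s x × inv (s ∷ʳ x) ≡ g)
  mixed-lastMove {s} μ g with choose u≢v (inv s) g
    where open Mixed μ
  ... | inj₁ eq = _ , Mixed.u-free μ , inv-move s refl eq
  ... | inj₂ eq = _ , Mixed.v-free μ , inv-move s refl eq

  -- Playing `a` or `b` flips what remains free below the gap to `e` and leaves the rest at `e`. The
  -- colours of `a` and `b` differ, which gives the choice of parity.
  split-move : ∀ {s e} → Split s e → ∀ g → ∃[ x ] (Free ⟦ D ⟧ s x × Uniform (s ∷ʳ x) e × inv (s ∷ʳ x) ≡ g)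
  split-move {s} {e} σ g with choose (p≢p⁻¹ e) (inv s) g
  ... | inj₁ eq = b , b-free , uniform , inv-move s (upper b b-free ℤ.≤-refl) eq
    where
    open Split σ
    uniform : Uniform (s ∷ʳ b) e
    uniform x free with free-∷ʳ⁻ {s} free
    ... | xf , x≢b with gap x xf
    ...   | inj₁ x≤a = trans (above-∷ʳ-< s (ℤ.≤-<-trans x≤a a<b))
                             (trans (cong _⁻¹ (lower x xf x≤a)) (⁻¹-involutive e))
    ...   | inj₂ b≤x = trans (above-∷ʳ-≥ s b≤x) (upper x xf b≤x)
  ... | inj₂ eq = a , a-free , uniform , inv-move s (lower a a-free ℤ.≤-refl) eq
    where
    open Split σ
    uniform : Uniform (s ∷ʳ a) e
    uniform x free with free-∷ʳ⁻ {s} free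
    ... | xf , x≢a with gap x xf
    ...   | inj₁ x≤a = trans (above-∷ʳ-< s (ℤ.≤∧≢⇒< x≤a x≢a))
                             (trans (cong _⁻¹ (lower x xf x≤a)) (⁻¹-involutive e))
    ...   | inj₂ b≤x = trans (above-∷ʳ-≥ s (ℤ.<⇒≤ (ℤ.<-≤-trans a<b b≤x))) (upper x xf b≤x)

  mixed-move : ∀ {s} → Mixed s → ∃[ x ] (Free ⟦ D ⟧ s x × Alternating (s ∷ʳ x))
  mixed-move with infinite D
  ... | inj₁ up   = mixed-move↑ up
  ... | inj₂ down = mixed-move↓ down

  -- The free neighbours of `x`, which exist because of `y` and `z`, border the new pivot:
  -- everything free below `x` is flipped, everything above keeps `e`.
  uniform-innerMove : ∀ {s e x y z} → Uniform s e → Free ⟦ D ⟧ s y → y < x →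
                      Free ⟦ D ⟧ s z → x < z → Split (s ∷ʳ x) e
  uniform-innerMove {s} {e} {x} υ y-free y<x z-free x<z =
    let a , af , a<x , greatest = greatestBelow (free? D s) y-free y<x
        b , bf , x<b , least    = leastAbove (free? D s) z-free x<z
    in record
      { a-free = free-∷ʳ⁺ af (ℤ.<⇒≢ a<x)
      ; b-free = free-∷ʳ⁺ bf (ℤ.<⇒≢ x<b ∘ sym)
      ; a<b    = ℤ.<-trans a<x x<b
      ; gap    = λ t tf → gap greatest least t (free-∷ʳ⁻ {s = s} tf)
      ; lower  = λ t tf t≤a → trans (above-∷ʳ-< s (ℤ.≤-<-trans t≤a a<x))
                                    (cong _⁻¹ (υ t (proj₁ (free-∷ʳ⁻ {s = s} tf))))
      ; upper  = λ t tf b≤t → trans (above-∷ʳ-≥ s (ℤ.≤-trans (ℤ.<⇒≤ x<b) b≤t))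
                                    (υ t (proj₁ (free-∷ʳ⁻ {s = s} tf)))
      }
    where
    gap : ∀ {a b} → (∀ t → Free ⟦ D ⟧ s t → t < x → t ≤ a) → (∀ t → Free ⟦ D ⟧ s t → x < t → b ≤ t) →
          ∀ t → Free ⟦ D ⟧ s t × t ≢ x → t ≤ a ⊎ b ≤ t
    gap greatest least t (tf , t≢x) with ℤ.<-cmp t x
    ... | tri< t<x _ _ = inj₁ (greatest t tf t<x)
    ... | tri≈ _ t≡x _ = contradiction t≡x t≢x
    ... | tri> _ _ x<t = inj₂ (least t tf x<t)

-- On a half-line without pivots, the only move that does not create a pivot is
-- the one at the end, and it changes the common colour e to next e.
ExtremalMove : Domain → (Parity → Parity) → List ℤ → Set
ExtremalMove D next s =
  ∃[ x ] (Free ⟦ D ⟧ s x ×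
          (∀ {e} → Colouring.Uniform D s e →
             Colouring.Uniform D (s ∷ʳ x) (next e) ×
             (∀ y → Free ⟦ D ⟧ s y → y ≢ x → Colouring.Split D (s ∷ʳ y) e)))

-- The move is the least free element. Nothing free lies below it, so no colour changes, whence
-- `id`. Any other free element has free elements on both sides.
extremalMove₊ : ∀ s → ExtremalMove ℤ₊ id s
extremalMove₊ s with Colouring.freeAbove ℤ₊ ℤ.≤-trans s {0ℤ} ℤ.≤-refl
... | M , 0<M , _ , free
  -- The search starts at `-1ℤ`, so that 0 is included.
  with leastAbove (free? ℤ₊ s) (free ℤ.≤-refl) (ℤ.≤-<-trans ℤ.-≤+ 0<M)
...   | x , xf , _ , least = x , xf , λ υ →
  (λ z zf → let zf′ = proj₁ (free-∷ʳ⁻ {s = s} zf)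
            in trans (above-∷ʳ-≥ s (least z zf′ (-1<free zf′))) (υ z zf′)) ,
  λ y yf y≢x →
    let N , y<N , _ , free = freeAbove ℤ.≤-trans s (proj₁ yf)
    in uniform-innerMove υ xf (ℤ.≤∧≢⇒< (least y yf (-1<free yf)) (y≢x ∘ sym)) (free ℤ.≤-refl) y<N
  where
  open Colouring ℤ₊
  -1<free : ∀ {z} → Free ⟦ ℤ₊ ⟧ s z → -1ℤ < z
  -1<free (0≤z , _) = ℤ.<-≤-trans ℤ.-<+ 0≤z

-- The move is the greatest free element. All other free elements lie below it and are flipped,
-- whence `_⁻¹`.
extremalMove₋ : ∀ s → ExtremalMove ℤ₋ _⁻¹ s
extremalMove₋ s with Colouring.freeBelow ℤ₋ (flip ℤ.≤-trans) s {0ℤ} ℤ.≤-refl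
... | M , M<0 , free
  with greatestBelow (free? ℤ₋ s) (free ℤ.≤-refl) (ℤ.<-trans M<0 0<1)
...   | x , xf , _ , greatest = x , xf , λ υ →
  (λ z zf → let zf′ , z≢x = free-∷ʳ⁻ {s = s} zf
            in trans (above-∷ʳ-< s (ℤ.≤∧≢⇒< (greatest z zf′ (free<1 zf′)) z≢x)) (cong _⁻¹ (υ z zf′))) ,
  λ y yf y≢x →
    let N , N<y , free = freeBelow (flip ℤ.≤-trans) s (proj₁ yf)
    in uniform-innerMove υ (free ℤ.≤-refl) N<y xf (ℤ.≤∧≢⇒< (greatest y yf (free<1 yf)) y≢x)
  where
  open Colouring ℤ₋
  free<1 : ∀ {z} → Free ⟦ ℤ₋ ⟧ s z → z < 1ℤ
  free<1 (z≤0 , _) = ℤ.≤-<-trans z≤0 0<1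

-- Players, and the final parity under forced moves.

_≟ₚ_ : (P Q : Player) → Dec (P ≡ Q)
black ≟ₚ black = yes refl
black ≟ₚ white = no λ ()
white ≟ₚ black = no λ ()
white ≟ₚ white = yes refl

opponent-involutive : ∀ P → opponent (opponent P) ≡ P
opponent-involutive black = refl
opponent-involutive white = refl

≢⇒≡opponent : ∀ {P Q} → P ≢ Q → P ≡ opponent Q
≢⇒≡opponent {black} {black} P≢Q = contradiction refl P≢Q
≢⇒≡opponent {black} {white} _   = refl
≢⇒≡opponent {white} {black} _   = refl
≢⇒≡opponent {white} {white} P≢Q = contradiction refl P≢Q

toMove-suc : ∀ n {P} → toMove n ≡ P → toMove (suc n) ≡ opponent P
toMove-suc n = cong opponent

toMove-pred : ∀ n {P} → toMove (suc n) ≡ P → toMove n ≡ opponent P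
toMove-pred n eq = trans (sym (opponent-involutive (toMove n))) (cong opponent eq)

toMove≢ : ∀ n {P Q} → toMove n ≡ P → P ≢ Q → toMove n ≢ Q
toMove≢ n eq P≢Q eq′ = P≢Q (trans (sym eq) eq′)

p+q+q≡p : ∀ p q → p + q + q ≡ p
p+q+q≡p p q = trans (+-assoc p q q) (trans (cong (p +_) (p+p≡0ℙ q)) (+-identityʳ p))

-- The final parity when n moves in a row are made at the end of the domain.
final : (Parity → Parity) → ℕ → Parity → Parity → Parity
final next zero    p e = p
final next (suc n) p e = final next n (p + e) (next e)

-- Since the first move adds `e`, starting from `p + e` makes the two copies of `e` cancel and
-- leaves `p` for the remaining moves.
final-surjective : ∀ next n e g → ∃[ p ] final next n p e ≡ g
final-surjective next zero    e g = g , refl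
final-surjective next (suc n) e g =
  let p , eq = final-surjective next n (next e) g
  in p + e , trans (cong (λ q → final next n q (next e)) (p+q+q≡p p e)) eq

-- Strategies of Black, and of both players on a half-line.

module Game (D : Domain) (goal : Player → Parity) where

  open Colouring D

  private
    Wins = WinningStrategy ⟦ D ⟧ goal

  win-finish : ∀ {P s} → Unique s → inv s ≡ goal P → Wins P zero s
  win-finish u eq = finish (subst (HasParity _) eq (inv⇒HasParity u))

  -- The invariant is at least one pivot when Black is to move and at least two when White is. On
  -- the last turn Black has both colours at hand.
  black-mixed       : ∀ n {s} → toMove n ≡ black → Unique s → Mixed s → Wins black n s
  black-alternating : ∀ n {s} → toMove n ≡ black → Unique s → Alternating s → Wins black (suc n) s

  -- The turn equation excludes `zero`, as `toMove zero` is `white`.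
  black-mixed (suc zero) turn u μ =
    let x , xf , eq = mixed-lastMove μ (goal black)
    in play turn x xf (win-finish (unique-∷ʳ u xf) eq)
  black-mixed (suc (suc n)) turn u μ =
    let x , xf , α = mixed-move μ
    in play turn x xf (black-alternating n (toMove-pred n (toMove-pred (suc n) turn)) (unique-∷ʳ u xf) α)

  black-alternating n turn u α = answer (toMove≢ (suc n) (toMove-suc n turn) λ ()) λ x xf →
    black-mixed n turn (unique-∷ʳ u xf) (alternating-move α)

  module HalfLine {next : Parity → Parity} (extremal : ∀ s → ExtremalMove D next s) where

    -- The player favoured by the sequence of end moves plays each of them when on turn. An opponent
    -- who strays from it creates a pivot, which `win-uniform-split` exploits.
    win-uniform : ∀ P n {s e} → Unique s → Uniform s e → goal P ≡ final next n (inv s) e → Wins P n s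
    white-split : ∀ n {s e} → toMove (suc n) ≡ white → Unique s → Split s e → Wins white (suc n) s
    win-uniform-split : ∀ P n {s e x} → toMove (suc n) ≢ P → Unique (s ∷ʳ x) → Uniform s e →
                        Free ⟦ D ⟧ s x → Split (s ∷ʳ x) e → goal P ≡ final next (suc n) (inv s) e →
                        Wins P n (s ∷ʳ x)

    win-uniform P zero    u υ eq = win-finish u (sym eq)
    win-uniform P (suc n) {s} {e} u υ eq with extremal s | toMove (suc n) ≟ₚ P
    ... | x , xf , ex | yes turn =
      play turn x xf (win-uniform P n (unique-∷ʳ u xf) (proj₁ (ex υ))
        (trans eq (cong (λ p → final next n p (next e)) (sym (inv-move s (υ x xf) refl)))))
    ... | x , xf , ex | no turn = answer turn reply
      where
      reply : ∀ y → Free ⟦ D ⟧ s y → Wins P n (s ∷ʳ y)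
      reply y yf with y ≟ x
      ... | yes refl = win-uniform P n (unique-∷ʳ u xf) (proj₁ (ex υ))
        (trans eq (cong (λ p → final next n p (next e)) (sym (inv-move s (υ x xf) refl))))
      ... | no y≢x =
        win-uniform-split P n turn (unique-∷ʳ u yf) υ yf (proj₂ (ex υ) y yf y≢x) eq

    win-uniform-split black n turn u υ xf σ eq =
      black-mixed n (toMove-pred n (≢⇒≡opponent turn)) u (split⇒mixed σ)
    -- Black strayed on the last turn; all free elements had the colour `e`, so the final parity is
    -- the same as after the end move.
    win-uniform-split white zero {s} {x = x} turn u υ xf σ eq =
      win-finish u (trans (inv-move s (υ x xf) refl) (sym eq))
    win-uniform-split white (suc n) turn u υ xf σ eq =
      white-split n (toMove-pred (suc n) (≢⇒≡opponent turn)) u σ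

    white-split n {e = e} turn u σ =
      -- White aims at the parity `p` which the `n` end moves that follow turn into `goal white`.
      let p , eq           = final-surjective next n e (goal white)
          x , xf , υ , inv≡p = split-move σ p
      in play turn x xf (win-uniform white n (unique-∷ʳ u xf) υ
           (sym (trans (cong (λ q → final next n q e) inv≡p) eq)))

-- Strategies on the whole of the integers.

module _ (goal : Player → Parity) where

  open Game ℤ-all goal
  open Colouring ℤ-all

  private
    Wins = WinningStrategy ⟦ ℤ-all ⟧ goal

    -- Every integer has free elements on both sides, so no move avoids creating a pivot.
    uniform-move : ∀ {s e x} → Uniform s e → Free ⟦ ℤ-all ⟧ s x → Split (s ∷ʳ x) e
    uniform-move {s} υ xf =
      let _ , y<x , yf     = freeBelow (λ _ _ → tt) s (proj₁ xf)
          _ , x<z , _ , zf = freeAbove (λ _ _ → tt) s (proj₁ xf)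
      in uniform-innerMove υ (yf ℤ.≤-refl) y<x (zf ℤ.≤-refl) x<z

  white-uniform-ℤ : ∀ n {s e} → toMove (suc n) ≡ white → Unique s → Uniform s e → Wins white (suc (suc n)) s
  white-split-ℤ   : ∀ n {s e} → toMove (suc n) ≡ white → Unique s → Split s e → Wins white (suc n) s

  white-uniform-ℤ n turn u υ = answer (toMove≢ (suc (suc n)) (toMove-suc (suc n) turn) λ ()) λ x xf →
    white-split-ℤ n turn (unique-∷ʳ u xf) (uniform-move υ xf)

  white-split-ℤ (suc zero) {s} {e} turn u σ =
    -- Black's last move adds `e` wherever it is made; White cancels it in advance.
    let x , xf , υ , inv≡ = split-move σ (goal white + e)
    in play turn x xf (answer (λ ()) λ y yf →
         win-finish (unique-∷ʳ (unique-∷ʳ u xf) yf)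
           (inv-move (s ∷ʳ x) (υ y yf) (trans (cong (_+ e) inv≡) (p+q+q≡p (goal white) e))))
  white-split-ℤ (suc (suc n)) turn u σ =
    -- Before White's last turn the parity is immaterial, and `0ℙ` is an arbitrary choice.
    let x , xf , υ , _ = split-move σ 0ℙ
    in play turn x xf (white-uniform-ℤ n (toMove-pred (suc n) (toMove-pred (suc (suc n)) turn)) (unique-∷ʳ u xf) υ)

  second-uniform-ℤ : ∀ n {s e} → Unique s → Uniform s e → Wins (secondPlayer (suc (suc n))) (suc (suc n)) s
  second-uniform-ℤ n {s} u υ =
    -- The second player is by definition a double opponent of the player to move when `suc n` turns
    -- remain.
    subst (λ P → Wins P (suc (suc n)) s) (sym (opponent-involutive (toMove (suc n)))) (go _ refl)
    where
    go : ∀ P → toMove (suc n) ≡ P → Wins P (suc (suc n)) s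
    go white turn = white-uniform-ℤ n turn u υ
    go black turn = answer (toMove≢ (suc (suc n)) (toMove-suc (suc n) turn) λ ()) λ x xf →
      black-mixed (suc n) turn (unique-∷ʳ u xf) (split⇒mixed (uniform-move υ xf))

-- Closed forms of the forced final parity.

final₊ : ∀ n p → final id n p 0ℙ ≡ p
final₊ zero    p = refl
final₊ (suc n) p = trans (final₊ n (p + 0ℙ)) (+-identityʳ p)

-- Two successive end moves add `e` and `e ⁻¹`, hence 1 in all, and restore the colour `e`.
final₋-2+ : ∀ n p e → final _⁻¹ (suc (suc n)) p e ≡ final _⁻¹ n (p ⁻¹) e
final₋-2+ n p e = cong₂ (final _⁻¹ n) (p+e+e⁻¹ p e) (⁻¹-involutive e)
  where
  p+e+e⁻¹ : ∀ p e → p + e + e ⁻¹ ≡ p ⁻¹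
  p+e+e⁻¹ 0ℙ 0ℙ = refl
  p+e+e⁻¹ 0ℙ 1ℙ = refl
  p+e+e⁻¹ 1ℙ 0ℙ = refl
  p+e+e⁻¹ 1ℙ 1ℙ = refl

+-parity-suc : ∀ p n → p ⁻¹ + parity n ≡ p + parity (suc n)
+-parity-suc p n = trans (+-⁻¹ˡ p (parity n))
  (trans (sym (+-⁻¹ʳ p (parity n))) (cong (p +_) (sym (parity-suc n))))

final₋-even : ∀ n p e → parity n ≡ 0ℙ → final _⁻¹ n p e ≡ p + parity ⌊ n /2⌋
final₋-even zero          p e _    = sym (+-identityʳ p)
final₋-even (suc (suc n)) p e even = begin
  final _⁻¹ (suc (suc n)) p e     ≡⟨ final₋-2+ n p e ⟩
  final _⁻¹ n (p ⁻¹) e            ≡⟨ final₋-even n (p ⁻¹) e even ⟩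
  p ⁻¹ + parity ⌊ n /2⌋           ≡⟨ +-parity-suc p ⌊ n /2⌋ ⟩
  p + parity (suc ⌊ n /2⌋)        ∎
  where open ≡-Reasoning

final₋-odd : ∀ n p e → parity n ≡ 1ℙ → final _⁻¹ n p e ≡ p + e + parity ⌊ n ∸ 1 /2⌋
final₋-odd (suc zero)          p e _   = sym (+-identityʳ (p + e))
final₋-odd (suc (suc (suc n))) p e odd = begin
  final _⁻¹ (suc (suc (suc n))) p e    ≡⟨ final₋-2+ (suc n) p e ⟩
  final _⁻¹ (suc n) (p ⁻¹) e           ≡⟨ final₋-odd (suc n) (p ⁻¹) e odd ⟩
  p ⁻¹ + e + parity ⌊ n /2⌋            ≡⟨ cong (_+ parity ⌊ n /2⌋) (+-⁻¹ˡ p e) ⟩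
  (p + e) ⁻¹ + parity ⌊ n /2⌋          ≡⟨ +-parity-suc (p + e) ⌊ n /2⌋ ⟩
  p + e + parity (suc ⌊ n /2⌋)         ∎
  where open ≡-Reasoning

-- Pivots and the end block in terms of colours.

Between : ℤ → ℤ → Pred ℤ 0ℓ
Between a b x = a < x × x < b

between? : ∀ a b → Decidable (Between a b)
between? a b x = a <? x ×-dec x <? b

-- As `b` is not in `s`, an element of `s` above `a` lies either between `a` and `b` or above `b`.
-- Thus the colours of `a` and `b` differ exactly when an odd number of elements lies between them.
above≡between+above : ∀ {a b} → a < b → ∀ s → b ∉ s →
                      above s a ≡ count (between? a b) s + above s b
above≡between+above         a<b []      b∉s = refl
above≡between+above {a} {b} a<b (x ∷ s) b∉s = go (ℤ.<-cmp x b) (a <? x)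
  where
  ih = above≡between+above a<b s (b∉s ∘ there)
  go : Tri (x < b) (x ≡ b) (b < x) → Dec (a < x) →
       above (x ∷ s) a ≡ count (between? a b) (x ∷ s) + above (x ∷ s) b
  go (tri≈ _ refl _) _ = contradiction (here refl) b∉s
  go (tri< x<b _ b≮x) (yes a<x)
    rewrite count-accept (a <?_) s a<x | count-reject (b <?_) s b≮x
          | count-accept (between? a b) s (a<x , x<b) =
    trans (cong _⁻¹ ih) (sym (+-⁻¹ˡ (count (between? a b) s) (above s b)))
  go (tri< _ _ b≮x) (no a≮x)
    rewrite count-reject (a <?_) s a≮x | count-reject (b <?_) s b≮x
          | count-reject (between? a b) s (a≮x ∘ proj₁) = ih
  go (tri> x≮b _ b<x) _
    rewrite count-accept (a <?_) s (ℤ.<-trans a<b b<x) | count-accept (b <?_) s b<x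
          | count-reject (between? a b) s (x≮b ∘ proj₂) =
    trans (cong _⁻¹ ih) (sym (+-⁻¹ʳ (count (between? a b) s) (above s b)))

-- Makes sizes independent of the enumeration chosen in `HasSize`.
length-unique : ∀ {xs ys : List ℤ} → Unique xs → Unique ys → (∀ {x} → x ∈ xs ⇔ x ∈ ys) →
                length xs ≡ length ys
length-unique ux uy eq = ↭-length (∼bag⇒↭ (unique∧set⇒bag ux uy eq))

module Pivots (D : Domain) (s : List ℤ) (uniq : Unique s) where

  open Position ⟦ D ⟧ s hiding (Free) renaming ([_,_] to Interval)
  open Colouring D

  private
    F = Free ⟦ D ⟧ s

  class-refl : ∀ {c} → c ∈ s → Class c c
  class-refl c∈s = c∈s , λ
    { x (inj₁ (c≤x , x≤c)) _ → subst (_∈ s) (ℤ.≤-antisym c≤x x≤c) c∈s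
    ; x (inj₂ (c≤x , x≤c)) _ → subst (_∈ s) (ℤ.≤-antisym c≤x x≤c) c∈s }

  -- Two consecutive free elements; what lies between them is empty or a single block.
  record Gap (a b : ℤ) : Set where
    field
      a-free : F a
      b-free : F b
      a<b    : a < b
      gap    : ∀ x → F x → x ≤ a ⊎ b ≤ x

    inside : ∀ {x} → Between a b x → x ∈ s
    inside {x} (a<x , x<b) with x ∈? s
    ... | yes x∈s = x∈s
    ... | no  x∉s with gap x (convex D (proj₁ a-free) (proj₁ b-free) (ℤ.<⇒≤ a<x) (ℤ.<⇒≤ x<b) , x∉s)
    ...   | inj₁ x≤a = contradiction x≤a (ℤ.<⇒≱ a<x)
    ...   | inj₂ b≤x = contradiction b≤x (ℤ.<⇒≱ x<b)

    class≐ : ∀ {c} → Between a b c → Class c ≐ Between a b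
    class≐ {c} (a<c , c<b) = to , λ z → inside z , λ x x∈[c,z] _ → inside (convex-between z x∈[c,z])
      where
      to : ∀ {z} → Class c z → Between a b z
      to (_ , c∼z) =
        ℤ.≰⇒> (λ z≤a → proj₂ a-free (c∼z a (inj₂ (z≤a , ℤ.<⇒≤ a<c)) (proj₁ a-free))) ,
        ℤ.≰⇒> (λ b≤z → proj₂ b-free (c∼z b (inj₁ (ℤ.<⇒≤ c<b , b≤z)) (proj₁ b-free)))
      convex-between : ∀ {z x} → Between a b z → Interval c z x → Between a b x
      convex-between (_ , z<b) (inj₁ (c≤x , x≤z)) = ℤ.<-≤-trans a<c c≤x , ℤ.≤-<-trans x≤z z<b
      convex-between (a<z , _) (inj₂ (z≤x , x≤c)) = ℤ.<-≤-trans a<z z≤x , ℤ.≤-<-trans x≤c c<b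

    above≡ : above s a ≡ count (between? a b) s + above s b
    above≡ = above≡between+above a<b s (proj₂ b-free)

    -- Different colours mean an odd number of elements in between. In particular there is one, and
    -- its class is the whole of `Between a b`.
    pivot : above s a ≢ above s b → IsPivot (Between a b)
    pivot a≢b with any? (between? a b) s
    ... | no  none = contradiction
      (trans above≡ (cong (_+ above s b) (count-none (between? a b) λ x x∈s bx → none (lose x∈s bx)))) a≢b
    ... | yes some =
      let c , c∈s , bc = find some
      in (c , c∈s , Product.swap (class≐ bc)) ,
         (_ , (filter (between? a b) s , Unique.filter⁺ (between? a b) uniq ,
               (λ x → mk⇔ (proj₂ ∘ ∈-filter⁻ (between? a b) {xs = s})
                          (λ bx → ∈-filter⁺ (between? a b) (inside bx) bx)) , refl) ,
          ≢⇒≡⁻¹ λ even → a≢b (trans above≡ (cong (_+ above s b) even))) ,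
         a , b , a-free , b-free , (λ _ → proj₁) , (λ _ → proj₂)

  -- The gap is formed by the free elements nearest to an element `c` of the block; the odd size of
  -- the block makes their colours differ.
  pivot⇒gap : ∀ {B} → IsPivot B → ∃[ a ] ∃[ b ] (Gap a b × B ≐ Between a b × above s a ≢ above s b)
  pivot⇒gap {B} ((c , c∈s , B⊆ , ⊆B) , (k , (ys , uys , ys≐B , len) , odd) , u , v , uf , vf , u<B , B<v)
    with ⊆B (class-refl c∈s)
  ... | Bc with greatestBelow (free? D s) uf (u<B c Bc) | leastAbove (free? D s) vf (B<v c Bc)
  ...   | a , af , a<c , greatest | b , bf , c<b , least = a , b , γ , B≐ , a≢b
    where
    gap : ∀ x → F x → x ≤ a ⊎ b ≤ x
    gap x xf with ℤ.<-cmp x c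
    ... | tri< x<c _ _ = inj₁ (greatest x xf x<c)
    ... | tri≈ _ refl _ = contradiction c∈s (proj₂ xf)
    ... | tri> _ _ c<x = inj₂ (least x xf c<x)
    γ : Gap a b
    γ = record { a-free = af ; b-free = bf ; a<b = ℤ.<-trans a<c c<b ; gap = gap }
    open Gap γ using (inside; class≐; above≡)
    B≐ : B ≐ Between a b
    B≐ = proj₁ (class≐ (a<c , c<b)) ∘ B⊆ , ⊆B ∘ proj₂ (class≐ (a<c , c<b))
    size : length (filter (between? a b) s) ≡ k
    size = trans (length-unique (Unique.filter⁺ (between? a b) uniq) uys λ {x} → mk⇔
      (Equivalence.from (ys≐B x) ∘ proj₂ B≐ ∘ proj₂ ∘ ∈-filter⁻ (between? a b) {xs = s})
      (λ x∈ys → let bx = proj₁ B≐ (Equivalence.to (ys≐B x) x∈ys)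
                in ∈-filter⁺ (between? a b) (inside bx) bx)) len
    a≢b : above s a ≢ above s b
    a≢b eq = p≢p⁻¹ (above s b) (trans (sym eq) (trans above≡
      (cong (_+ above s b) (trans (cong parity size) odd))))

  -- Here `a` is the last free element below `v` with the colour of `u`, and `b` is the next free
  -- element. It cannot share that colour, by the choice of `a` if it is below `v` and by assumption
  -- if it is `v`.
  colourChange⇒gap : ∀ {u v} → F u → F v → u < v → above s u ≢ above s v →
                     ∃[ a ] ∃[ b ] (Gap a b × u ≤ a × b ≤ v × above s a ≢ above s b)
  colourChange⇒gap {u} {v} uf vf u<v u≢v
    with greatestBelow (λ x → free? D s x ×-dec above s x ℙ.≟ above s u) (uf , refl) u<v
  ... | a , (af , a≡u) , a<v , greatest with leastAbove (free? D s) vf a<v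
  ...   | b , bf , a<b , least = a , b , γ , greatest u (uf , refl) u<v , b≤v , a≢b
    where
    b≤v = least v vf a<v
    γ : Gap a b
    γ = record { a-free = af ; b-free = bf ; a<b = a<b ; gap = gap }
      where
      gap : ∀ x → F x → x ≤ a ⊎ b ≤ x
      gap x xf with x ≤? a
      ... | yes x≤a = inj₁ x≤a
      ... | no  x≰a = inj₂ (least x xf (ℤ.≰⇒> x≰a))
    a≢b : above s a ≢ above s b
    a≢b a≡b = ℤ.<⇒≱ a<b (greatest b (bf , b≡u) (ℤ.≤∧≢⇒< b≤v λ { refl → u≢v (sym b≡u) }))
      where b≡u = trans (sym a≡b) a≡u

  noPivot⇒uniform : NoPivot → ∀ {x} → F x → Uniform s (above s x)
  noPivot⇒uniform none {x} xf y yf with above s y ℙ.≟ above s x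
  ... | yes eq = eq
  ... | no neq with ℤ.<-cmp y x
  ...   | tri≈ _ refl _ = refl
  ...   | tri< y<x _ _ =
    let _ , _ , γ , _ , _ , a≢b = colourChange⇒gap yf xf y<x neq
    in contradiction (Gap.pivot γ a≢b) (none _)
  ...   | tri> _ _ x<y =
    let _ , _ , γ , _ , _ , a≢b = colourChange⇒gap xf yf x<y (neq ∘ sym)
    in contradiction (Gap.pivot γ a≢b) (none _)

  pivot⇒mixed : ∀ {B} → IsPivot B → Mixed s
  pivot⇒mixed π =
    let _ , _ , γ , _ , a≢b = pivot⇒gap π
    in record { u-free = Gap.a-free γ ; v-free = Gap.b-free γ ; u<v = Gap.a<b γ ; u≢v = a≢b }

  exactlyOnePivot⇒split : ExactlyOnePivot → ∃[ e ] Split s e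
  exactlyOnePivot⇒split (B , π , only) with pivot⇒gap π
  ... | a , b , γ , B≐ , a≢b = above s b , record
    { a-free = a-free ; b-free = b-free ; a<b = a<b ; gap = gap ; lower = lower ; upper = upper }
    where
    open Gap γ
    -- Any colour change is a pivot and so coincides with `B`; a common element `z` of the two gaps
    -- is enough to refute a change away from `B`.
    inB : ∀ {c d} → Gap c d → above s c ≢ above s d → ∃[ z ] (Between a b z × Between c d z)
    inB δ c≢d with Gap.pivot δ c≢d
    ... | ϖ@((z , z∈s , _ , class⊆) , _) =
      let cz = class⊆ (class-refl z∈s)
      in z , proj₁ B≐ (proj₁ (only _ ϖ) cz) , cz
    lower : ∀ x → F x → x ≤ a → above s x ≡ above s b ⁻¹
    lower x xf x≤a with above s x ℙ.≟ above s a
    ... | yes eq = trans eq (≢⇒≡⁻¹ a≢b)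
    ... | no neq =
      let _ , _ , δ , _ , d≤a , c≢d = colourChange⇒gap xf a-free (ℤ.≤∧≢⇒< x≤a λ { refl → neq refl }) neq
          _ , (a<z , _) , (_ , z<d) = inB δ c≢d
      in contradiction d≤a (ℤ.<⇒≱ (ℤ.<-trans a<z z<d))
    upper : ∀ x → F x → b ≤ x → above s x ≡ above s b
    upper x xf b≤x with above s x ℙ.≟ above s b
    ... | yes eq = eq
    ... | no neq =
      let _ , _ , δ , b≤c , _ , c≢d = colourChange⇒gap b-free xf (ℤ.≤∧≢⇒< b≤x λ { refl → neq refl }) (neq ∘ sym)
          _ , (_ , z<b) , (c<z , _) = inB δ c≢d
      in contradiction b≤c (ℤ.<⇒≱ (ℤ.<-trans c<z z<b))

  -- If `b` and `c` have the same colour, then `a`, `b`, `d` alternate; otherwise `a`, `b`, `c` do.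
  consecutive⇒alternating : ∀ {a b c d} → Gap a b → Gap c d → b ≤ c →
    above s a ≢ above s b → above s c ≢ above s d → Alternating s
  consecutive⇒alternating {a} {b} {c} {d} γ δ b≤c a≢b c≢d with above s b ℙ.≟ above s c
  ... | yes b≡c = record
    { u-free = Gap.a-free γ ; v-free = Gap.b-free γ ; w-free = Gap.b-free δ
    ; u<v = Gap.a<b γ ; v<w = ℤ.≤-<-trans b≤c (Gap.a<b δ)
    ; u≢v = a≢b ; v≢w = λ eq → c≢d (trans (sym b≡c) eq) }
  ... | no b≢c = record
    { u-free = Gap.a-free γ ; v-free = Gap.b-free γ ; w-free = Gap.a-free δ
    ; u<v = Gap.a<b γ ; v<w = ℤ.≤∧≢⇒< b≤c λ { refl → b≢c refl }
    ; u≢v = a≢b ; v≢w = b≢c }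

  -- No endpoint of one gap lies strictly inside the other, since endpoints are free.
  gap-cmp : ∀ {a b c d} → Gap a b → Gap c d → b ≤ c ⊎ d ≤ a ⊎ (a ≡ c × b ≡ d)
  gap-cmp γ δ with Gap.gap γ _ (Gap.a-free δ) | Gap.gap δ _ (Gap.a-free γ)
                 | Gap.gap γ _ (Gap.b-free δ) | Gap.gap δ _ (Gap.b-free γ)
  ... | inj₂ b≤c | _        | _        | _        = inj₁ b≤c
  ... | inj₁ _   | inj₂ d≤a | _        | _        = inj₂ (inj₁ d≤a)
  ... | inj₁ _   | inj₁ _   | inj₁ d≤a | _        = inj₂ (inj₁ d≤a)
  ... | inj₁ _   | inj₁ _   | inj₂ _   | inj₁ b≤c = inj₁ b≤c
  ... | inj₁ c≤a | inj₁ a≤c | inj₂ b≤d | inj₂ d≤b =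
    inj₂ (inj₂ (ℤ.≤-antisym a≤c c≤a , ℤ.≤-antisym b≤d d≤b))

  moreThanOnePivot⇒alternating : MoreThanOnePivot → Alternating s
  moreThanOnePivot⇒alternating (B , C , πB , πC , B≭C) with pivot⇒gap πB | pivot⇒gap πC
  ... | a , b , γ , (B⊆ , ⊆B) , a≢b | c , d , δ , (C⊆ , ⊆C) , c≢d with gap-cmp γ δ
  ...   | inj₁ b≤c        = consecutive⇒alternating γ δ b≤c a≢b c≢d
  ...   | inj₂ (inj₁ d≤a) = consecutive⇒alternating δ γ d≤a c≢d a≢b
  ...   | inj₂ (inj₂ (refl , refl)) = ⊥-elim (B≭C (⊆C ∘ B⊆ , ⊆B ∘ C⊆))

-- The elements of `s` above the greatest free element are those of the end block, which may be
-- empty, so the colour of this element is the parity of `ℓ`.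
endBlock-parity : ∀ {s} → All ⟦ ℤ₋ ⟧ s → Unique s → ∀ {ℓ} → HasSize (Position.EndBlock ⟦ ℤ₋ ⟧ s) ℓ →
                  ∃[ x ] (Free ⟦ ℤ₋ ⟧ s x × above s x ≡ parity ℓ)
endBlock-parity {s} s≤0 uniq {ℓ} (ys , uys , ys≐E , len)
  with Colouring.freeBelow ℤ₋ (flip ℤ.≤-trans) s {0ℤ} ℤ.≤-refl
... | M , M<0 , free
  with greatestBelow (free? ℤ₋ s) (free ℤ.≤-refl) (ℤ.<-trans M<0 0<1)
...   | a , af , _ , greatest = a , af , cong parity (trans (length-unique
          (Unique.filter⁺ (a <?_) uniq) uys λ {x} → mk⇔
            (λ x∈ → let x∈s , a<x = ∈-filter⁻ (a <?_) {xs = s} x∈ in Equivalence.from (ys≐E x) (from x∈s a<x))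
            (λ x∈ys → let E = Equivalence.to (ys≐E x) x∈ys in ∈-filter⁺ (a <?_) (∈s E) (to E))) len)
  where
  open Position ⟦ ℤ₋ ⟧ s hiding (Free)
  inside : ∀ {x} → a < x → x ≤ 0ℤ → x ∈ s
  inside {x} a<x x≤0 with x ∈? s
  ... | yes x∈s = x∈s
  ... | no  x∉s = contradiction
    (greatest x (x≤0 , x∉s) (ℤ.≤-<-trans x≤0 0<1)) (ℤ.<⇒≱ a<x)
  ∈s : ∀ {x} → EndBlock x → x ∈ s
  ∈s (_ , _ , _ , x∈s , _) = x∈s
  to : ∀ {x} → EndBlock x → a < x
  to (e , (_ , last) , e∈s , x∈s , e∼x) = ℤ.≰⇒> λ x≤a →
    proj₂ af (e∼x a (inj₂ (x≤a , last a (proj₁ af))) (proj₁ af))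
  from : ∀ {x} → x ∈ s → a < x → EndBlock x
  from {x} x∈s a<x = 0ℤ , (ℤ.≤-refl , λ _ → id) , inside (ℤ.<-≤-trans a<x x≤0) ℤ.≤-refl , x∈s ,
    λ { z (inj₁ (0≤z , z≤x)) z≤0 → inside (ℤ.<-≤-trans a<x (ℤ.≤-trans x≤0 0≤z)) z≤0
      ; z (inj₂ (x≤z , _))   z≤0 → inside (ℤ.<-≤-trans a<x x≤z) z≤0 }
    where x≤0 = All.lookup s≤0 x∈s

-- The cases of the theorem.

white-split-any : ∀ D goal n {s e} → toMove (suc n) ≡ white → Unique s → Colouring.Split D s e →
                  WinningStrategy ⟦ D ⟧ goal white (suc n) s
white-split-any ℤ-all goal n = white-split-ℤ goal n
white-split-any ℤ₊    goal n = Game.HalfLine.white-split ℤ₊ goal extremalMove₊ n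
white-split-any ℤ₋    goal n = Game.HalfLine.white-split ℤ₋ goal extremalMove₋ n

noPivot-ℤ : ∀ {s n} goal → Unique s → Position.NoPivot ⟦ ℤ-all ⟧ s → 2 ℕ.≤ n →
            WinningStrategy ⟦ ℤ-all ⟧ goal (secondPlayer n) n s
noPivot-ℤ {s} goal u none (ℕ.s≤s (ℕ.s≤s {n = n} _)) =
  let _ , _ , _ , free = Colouring.freeAbove ℤ-all (λ _ _ → tt) s {0ℤ} tt
  in second-uniform-ℤ goal n u (Pivots.noPivot⇒uniform ℤ-all s u none (free ℤ.≤-refl))

noPivot₊ : ∀ {s} n goal → Unique s → Position.NoPivot ⟦ ℤ₊ ⟧ s →
           ∀ p → HasParity s p → ∀ P → goal P ≡ p → WinningStrategy ⟦ ℤ₊ ⟧ goal P n s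
noPivot₊ {s} n goal u none p hp P eq =
  let M , _ , s<M , free = Colouring.freeAbove ℤ₊ ℤ.≤-trans s {0ℤ} ℤ.≤-refl
  in Game.HalfLine.win-uniform ℤ₊ goal extremalMove₊ P n u
       -- The common colour is read off at `M`, which lies above all of `s`; hence it is `0ℙ`.
       (subst (Colouring.Uniform ℤ₊ s) (count-none (M <?_) λ x x∈s → ℤ.<-asym (s<M x∈s))
         (Pivots.noPivot⇒uniform ℤ₊ s u none (free ℤ.≤-refl)))
       (trans eq (trans (HasParity⇒inv u hp) (sym (final₊ n (inv s)))))

noPivot₋ : ∀ {s} n goal → All ⟦ ℤ₋ ⟧ s → Unique s → Position.NoPivot ⟦ ℤ₋ ⟧ s →
           ∀ p ℓ → HasParity s p → HasSize (Position.EndBlock ⟦ ℤ₋ ⟧ s) ℓ →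
           (parity n ≡ 0ℙ →
             ∀ P → goal P ≡ p + parity ⌊ n /2⌋ → WinningStrategy ⟦ ℤ₋ ⟧ goal P n s) ×
           (parity n ≡ 1ℙ →
             ∀ P → goal P ≡ p + parity ℓ + parity ⌊ n ∸ 1 /2⌋ → WinningStrategy ⟦ ℤ₋ ⟧ goal P n s)
noPivot₋ {s} n goal s≤0 u none p ℓ hp size with HasParity⇒inv u hp | endBlock-parity s≤0 u size
... | refl | x , xf , eq =
  (λ even P g → win P (trans g (sym (final₋-even n p (parity ℓ) even)))) ,
  (λ odd  P g → win P (trans g (sym (final₋-odd n p (parity ℓ) odd))))
  where
  win : ∀ P → goal P ≡ final _⁻¹ n (inv s) (parity ℓ) → WinningStrategy ⟦ ℤ₋ ⟧ goal P n s
  win P = Game.HalfLine.win-uniform ℤ₋ goal extremalMove₋ P n u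
    (subst (Colouring.Uniform ℤ₋ s) eq (Pivots.noPivot⇒uniform ℤ₋ s u none xf))

theorem3p1 : (D : Domain) (s : List ℤ) (n : ℕ) (goal : Player → Parity) →
    All ⟦ D ⟧ s → Unique s → 1 ℕ.≤ n → goal black ≢ goal white →
    let open Position ⟦ D ⟧ s
        Wins : Player → Set
        Wins P = WinningStrategy ⟦ D ⟧ goal P n s
    in
    (ExactlyOnePivot → Wins (firstPlayer n)) ×
    (MoreThanOnePivot → Wins black) ×
    (NoPivot →
      -- For n = 1 the final parity is the initial one, whoever wants it.
      (D ≡ ℤ-all → 2 ℕ.≤ n → Wins (secondPlayer n)) ×
      (D ≡ ℤ₊ → ∀ p → HasParity s p → ∀ P → goal P ≡ p → Wins P) ×
      (D ≡ ℤ₋ → ∀ p ℓ → HasParity s p → HasSize EndBlock ℓ →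
        (parity n ≡ 0ℙ →
          ∀ P → goal P ≡ p + parity ⌊ n /2⌋ → Wins P) ×
        (parity n ≡ 1ℙ →
          ∀ P → goal P ≡ p + parity ℓ + parity ⌊ n ∸ 1 /2⌋ → Wins P)))
theorem3p1 D s (suc n) goal s⊆D u (ℕ.s≤s _) _ = one , many , λ none →
  (λ { refl 2≤n → noPivot-ℤ goal u none 2≤n }) ,
  (λ { refl p hp P eq → noPivot₊ (suc n) goal u none p hp P eq }) ,
  (λ { refl p ℓ hp size → noPivot₋ (suc n) goal s⊆D u none p ℓ hp size })
  where
  open Pivots D s u
  Wins : Player → Set
  Wins P = WinningStrategy ⟦ D ⟧ goal P (suc n) s
  one : Position.ExactlyOnePivot ⟦ D ⟧ s → Wins (toMove (suc n))
  one π = go _ refl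
    where
    σ = proj₂ (exactlyOnePivot⇒split π)
    go : ∀ P → toMove (suc n) ≡ P → Wins P
    -- Black uses only that a pivot exists, White also that there is no other.
    go black turn = Game.black-mixed D goal (suc n) turn u (Colouring.split⇒mixed D σ)
    go white turn = white-split-any D goal n turn u σ
  many : Position.MoreThanOnePivot ⟦ D ⟧ s → Wins black
  many π@(_ , _ , πB , _) = go _ refl
    where
    go : ∀ P → toMove (suc n) ≡ P → Wins black
    go black turn = Game.black-mixed D goal (suc n) turn u (pivot⇒mixed πB)
    go white turn = Game.black-alternating D goal n (toMove-pred n turn) u (moreThanOnePivot⇒alternating π)
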